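{- For every positive integer $k$ divisible by $9$ there exists a total $0$-$1$ matrix $M$ with $\operatorname{rank}_+(M)=k$ and $\operatorname{rank}_{0,1}(M)=\frac{4}{3}k$.
   Context: A total $0$-$1$ matrix is a finite matrix all of whose entries are in $\{0,1\}$. For a total $0$-$1$ matrix $M$ of size $n\times m$: the nonnegative rank $\operatorname{rank}_+(M)$ is the smallest $r$ such that $M=UV$ with $U$ an $n\times r$ and $V$ an $r\times m$ real matrix, both entrywise nonnegative; the binary rank $\operatorname{rank}_{0,1}(M)$ is the smallest $r$ such that $M=UV$ (ordinary arithmetic over the reals) with $U$ an $n\times r$ and $V$ an $r\times m$ matrix, both with all entries in $\{0,1\}$. -}

module Defs where

open import Data.Fin.Base using (Fin)
open import Data.Nat.Base as ℕ using (ℕ)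
import Data.Nat.Properties as ℕₚ
open import Data.Product.Base using (∃-syntax; _×_; _,_)
open import Data.Rational.Base as ℚ using (ℚ; 0ℚ; 1ℚ; ½; ∣_∣; 1/_)
import Data.Rational.Properties as ℚₚ
open import Data.Rational.Solver using (module +-*-Solver)
open import Data.Sum.Base using (_⊎_)
open import Data.Vec.Functional using (foldr)
open import Relation.Binary.PropositionalEquality using (_≡_; refl; sym; trans; cong; subst)

-- The reals are Cauchy sequences of rationals.  As there are no quotient
-- types, equality of reals is the relation _≃_ below, not _≡_.

IsCauchy : (ℕ → ℚ) → Set
IsCauchy x = ∀ ε → 0ℚ ℚ.< ε →
  ∃[ N ] ∀ m n → N ℕ.≤ m → N ℕ.≤ n → ∣ x m ℚ.- x n ∣ ℚ.< ε

record ℝ : Set where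
  constructor mkℝ
  field
    seq    : ℕ → ℚ
    cauchy : IsCauchy seq

open ℝ public

infix  4 _≃_ _≤_
infixl 6 _+_
infixl 7 _*_

_≃_ : ℝ → ℝ → Set
x ≃ y = ∀ ε → 0ℚ ℚ.< ε →
  ∃[ N ] ∀ n → N ℕ.≤ n → ∣ seq x n ℚ.- seq y n ∣ ℚ.< ε

_≤_ : ℝ → ℝ → Set
x ≤ y = ∀ ε → 0ℚ ℚ.< ε →
  ∃[ N ] ∀ n → N ℕ.≤ n → seq x n ℚ.< seq y n ℚ.+ ε

fromℚ : ℚ → ℝ
fromℚ q = mkℝ (λ _ → q) λ ε 0<ε → 0 , λ _ _ _ _ →
  subst (ℚ._< ε) (sym (cong ∣_∣ (ℚₚ.+-inverseʳ q))) 0<ε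

0ℝ 1ℝ : ℝ
0ℝ = fromℚ 0ℚ
1ℝ = fromℚ 1ℚ

half-pos : ∀ {ε} → 0ℚ ℚ.< ε → 0ℚ ℚ.< ½ ℚ.* ε
half-pos {ε} 0<ε =
  ℚₚ.positive⁻¹ (½ ℚ.* ε) {{ℚₚ.pos*pos⇒pos ½ ε {{ℚ.positive 0<ε}}}}

half+half : ∀ ε → ½ ℚ.* ε ℚ.+ ½ ℚ.* ε ≡ ε
half+half ε = trans (sym (ℚₚ.*-distribʳ-+ ε ½ ½)) (ℚₚ.*-identityˡ ε)

private
  open +-*-Solver

  rearrange : ∀ a b c d → (a ℚ.+ b) ℚ.- (c ℚ.+ d) ≡ (a ℚ.- c) ℚ.+ (b ℚ.- d)
  rearrange = solve 4 (λ a b c d → (a :+ b) :- (c :+ d) := (a :- c) :+ (b :- d)) refl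

  split : ∀ a b → a ≡ (a ℚ.- b) ℚ.+ b
  split = solve 2 (λ a b → a := (a :- b) :+ b) refl

  telescope : ∀ a b c d →
    a ℚ.* b ℚ.- c ℚ.* d ≡ a ℚ.* (b ℚ.- d) ℚ.+ d ℚ.* (a ℚ.- c)
  telescope = solve 4 (λ a b c d →
    a :* b :- c :* d := a :* (b :- d) :+ d :* (a :- c)) refl

+-cauchy : ∀ {x y} → IsCauchy x → IsCauchy y → IsCauchy (λ n → x n ℚ.+ y n)
+-cauchy {x} {y} cx cy ε 0<ε =
  combine (cx (½ ℚ.* ε) (half-pos 0<ε)) (cy (½ ℚ.* ε) (half-pos 0<ε))
  where
  open ℚₚ.≤-Reasoning
  combine :
    (∃[ N ] ∀ m n → N ℕ.≤ m → N ℕ.≤ n → ∣ x m ℚ.- x n ∣ ℚ.< ½ ℚ.* ε) →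
    (∃[ N ] ∀ m n → N ℕ.≤ m → N ℕ.≤ n → ∣ y m ℚ.- y n ∣ ℚ.< ½ ℚ.* ε) →
    ∃[ N ] ∀ m n → N ℕ.≤ m → N ℕ.≤ n →
      ∣ (x m ℚ.+ y m) ℚ.- (x n ℚ.+ y n) ∣ ℚ.< ε
  combine (N₁ , p) (N₂ , q) = N₁ ℕ.⊔ N₂ , λ m n N≤m N≤n → begin-strict
    ∣ (x m ℚ.+ y m) ℚ.- (x n ℚ.+ y n) ∣
      ≡⟨ cong ∣_∣ (rearrange (x m) (y m) (x n) (y n)) ⟩
    ∣ (x m ℚ.- x n) ℚ.+ (y m ℚ.- y n) ∣
      ≤⟨ ℚₚ.∣p+q∣≤∣p∣+∣q∣ (x m ℚ.- x n) (y m ℚ.- y n) ⟩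
    ∣ x m ℚ.- x n ∣ ℚ.+ ∣ y m ℚ.- y n ∣
      <⟨ ℚₚ.+-mono-<
           (p m n (ℕₚ.m⊔n≤o⇒m≤o N₁ N₂ N≤m) (ℕₚ.m⊔n≤o⇒m≤o N₁ N₂ N≤n))
           (q m n (ℕₚ.m⊔n≤o⇒n≤o N₁ N₂ N≤m) (ℕₚ.m⊔n≤o⇒n≤o N₁ N₂ N≤n)) ⟩
    ½ ℚ.* ε ℚ.+ ½ ℚ.* ε
      ≡⟨ half+half ε ⟩
    ε ∎

eventually-bounded : ∀ {x} → IsCauchy x →
  ∃[ B ] 0ℚ ℚ.< B × (∃[ N ] ∀ n → N ℕ.≤ n → ∣ x n ∣ ℚ.≤ B)
eventually-bounded {x} cx = bound (cx 1ℚ (ℚₚ.positive⁻¹ 1ℚ))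
  where
  open ℚₚ.≤-Reasoning
  bound :
    (∃[ N ] ∀ m n → N ℕ.≤ m → N ℕ.≤ n → ∣ x m ℚ.- x n ∣ ℚ.< 1ℚ) →
    ∃[ B ] 0ℚ ℚ.< B × (∃[ N ] ∀ n → N ℕ.≤ n → ∣ x n ∣ ℚ.≤ B)
  bound (N , p) = 1ℚ ℚ.+ ∣ x N ∣
    , ℚₚ.+-mono-<-≤ {0ℚ} {1ℚ} {0ℚ} {∣ x N ∣} (ℚₚ.positive⁻¹ 1ℚ) (ℚₚ.0≤∣p∣ (x N))
    , N , λ n N≤n → begin
      ∣ x n ∣
        ≡⟨ cong ∣_∣ (split (x n) (x N)) ⟩
      ∣ (x n ℚ.- x N) ℚ.+ x N ∣
        ≤⟨ ℚₚ.∣p+q∣≤∣p∣+∣q∣ (x n ℚ.- x N) (x N) ⟩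
      ∣ x n ℚ.- x N ∣ ℚ.+ ∣ x N ∣
        ≤⟨ ℚₚ.+-monoˡ-≤ ∣ x N ∣ (ℚₚ.<⇒≤ (p n N N≤n ℕₚ.≤-refl)) ⟩
      1ℚ ℚ.+ ∣ x N ∣ ∎

∣p*q∣<r*s : ∀ p q {r s} → 0ℚ ℚ.< r → ∣ p ∣ ℚ.≤ r → ∣ q ∣ ℚ.< s → ∣ p ℚ.* q ∣ ℚ.< r ℚ.* s
∣p*q∣<r*s p q {r} {s} 0<r p≤r q<s = begin-strict
  ∣ p ℚ.* q ∣      ≡⟨ ℚₚ.∣p*q∣≡∣p∣*∣q∣ p q ⟩
  ∣ p ∣ ℚ.* ∣ q ∣  ≤⟨ ℚₚ.*-monoʳ-≤-nonNeg ∣ q ∣ {{ℚ.nonNegative (ℚₚ.0≤∣p∣ q)}} p≤r ⟩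
  r ℚ.* ∣ q ∣      <⟨ ℚₚ.*-monoʳ-<-pos r {{ℚ.positive 0<r}} q<s ⟩
  r ℚ.* s          ∎
  where open ℚₚ.≤-Reasoning

shrink : ∀ r ε → 0ℚ ℚ.< r → 0ℚ ℚ.< ε → ∃[ δ ] 0ℚ ℚ.< δ × r ℚ.* δ ≡ ε
shrink r ε 0<r 0<ε = 1/r ℚ.* ε
  , ℚₚ.positive⁻¹ (1/r ℚ.* ε) {{ℚₚ.pos*pos⇒pos 1/r {{ℚₚ.1/pos⇒pos r}} ε}}
  , trans (sym (ℚₚ.*-assoc r 1/r ε))
      (trans (cong (ℚ._* ε) (ℚₚ.*-inverseʳ r)) (ℚₚ.*-identityˡ ε))
  where
  instance
    _ = ℚ.positive 0<r
    _ = ℚ.positive 0<ε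
    _ = ℚₚ.pos⇒nonZero r
  1/r : ℚ
  1/r = 1/ r

*-cauchy : ∀ {x y} → IsCauchy x → IsCauchy y → IsCauchy (λ n → x n ℚ.* y n)
*-cauchy {x} {y} cx cy ε 0<ε =
  choose (eventually-bounded cx) (eventually-bounded cy)
  where
  open ℚₚ.≤-Reasoning

  Goal : Set
  Goal = ∃[ N ] ∀ m n → N ℕ.≤ m → N ℕ.≤ n →
    ∣ x m ℚ.* y m ℚ.- x n ℚ.* y n ∣ ℚ.< ε

  combine : ∀ {A B δ N₁ N₂} → 0ℚ ℚ.< A → 0ℚ ℚ.< B → (A ℚ.+ B) ℚ.* δ ≡ ε →
    (∀ n → N₁ ℕ.≤ n → ∣ x n ∣ ℚ.≤ A) →
    (∀ n → N₂ ℕ.≤ n → ∣ y n ∣ ℚ.≤ B) →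
    (∃[ N ] ∀ m n → N ℕ.≤ m → N ℕ.≤ n → ∣ x m ℚ.- x n ∣ ℚ.< δ) →
    (∃[ N ] ∀ m n → N ℕ.≤ m → N ℕ.≤ n → ∣ y m ℚ.- y n ∣ ℚ.< δ) →
    Goal
  combine {A} {B} {δ} {N₁} {N₂} 0<A 0<B δ-eq boundx boundy (N₃ , p) (N₄ , q) =
    (N₁ ℕ.⊔ N₂) ℕ.⊔ (N₃ ℕ.⊔ N₄) , λ m n N≤m N≤n → begin-strict
    ∣ x m ℚ.* y m ℚ.- x n ℚ.* y n ∣
      ≡⟨ cong ∣_∣ (telescope (x m) (y m) (x n) (y n)) ⟩
    ∣ x m ℚ.* (y m ℚ.- y n) ℚ.+ y n ℚ.* (x m ℚ.- x n) ∣
      ≤⟨ ℚₚ.∣p+q∣≤∣p∣+∣q∣ (x m ℚ.* (y m ℚ.- y n)) (y n ℚ.* (x m ℚ.- x n)) ⟩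
    ∣ x m ℚ.* (y m ℚ.- y n) ∣ ℚ.+ ∣ y n ℚ.* (x m ℚ.- x n) ∣
      <⟨ ℚₚ.+-mono-<
           (∣p*q∣<r*s (x m) (y m ℚ.- y n) 0<A (boundx m (le₁ N≤m)) (q m n (le₄ N≤m) (le₄ N≤n)))
           (∣p*q∣<r*s (y n) (x m ℚ.- x n) 0<B (boundy n (le₂ N≤n)) (p m n (le₃ N≤m) (le₃ N≤n))) ⟩
    A ℚ.* δ ℚ.+ B ℚ.* δ
      ≡⟨ ℚₚ.*-distribʳ-+ δ A B ⟨
    (A ℚ.+ B) ℚ.* δ
      ≡⟨ δ-eq ⟩
    ε ∎
    where
    module _ {n} (N≤n : (N₁ ℕ.⊔ N₂) ℕ.⊔ (N₃ ℕ.⊔ N₄) ℕ.≤ n) where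
      le₁₂ : N₁ ℕ.⊔ N₂ ℕ.≤ n
      le₁₂ = ℕₚ.m⊔n≤o⇒m≤o (N₁ ℕ.⊔ N₂) (N₃ ℕ.⊔ N₄) N≤n
      le₃₄ : N₃ ℕ.⊔ N₄ ℕ.≤ n
      le₃₄ = ℕₚ.m⊔n≤o⇒n≤o (N₁ ℕ.⊔ N₂) (N₃ ℕ.⊔ N₄) N≤n
      le₁ : N₁ ℕ.≤ n
      le₁ = ℕₚ.m⊔n≤o⇒m≤o N₁ N₂ le₁₂
      le₂ : N₂ ℕ.≤ n
      le₂ = ℕₚ.m⊔n≤o⇒n≤o N₁ N₂ le₁₂
      le₃ : N₃ ℕ.≤ n
      le₃ = ℕₚ.m⊔n≤o⇒m≤o N₃ N₄ le₃₄
      le₄ : N₄ ℕ.≤ n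
      le₄ = ℕₚ.m⊔n≤o⇒n≤o N₃ N₄ le₃₄

  choose :
    (∃[ A ] 0ℚ ℚ.< A × (∃[ N ] ∀ n → N ℕ.≤ n → ∣ x n ∣ ℚ.≤ A)) →
    (∃[ B ] 0ℚ ℚ.< B × (∃[ N ] ∀ n → N ℕ.≤ n → ∣ y n ∣ ℚ.≤ B)) →
    Goal
  choose (A , 0<A , N₁ , boundx) (B , 0<B , N₂ , boundy) =
    pick (shrink (A ℚ.+ B) ε (ℚₚ.+-mono-< {0ℚ} {A} {0ℚ} {B} 0<A 0<B) 0<ε)
    where
    pick : (∃[ δ ] 0ℚ ℚ.< δ × (A ℚ.+ B) ℚ.* δ ≡ ε) → Goal
    pick (δ , 0<δ , δ-eq) = combine 0<A 0<B δ-eq boundx boundy (cx δ 0<δ) (cy δ 0<δ)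

_+_ : ℝ → ℝ → ℝ
x + y = mkℝ (λ n → seq x n ℚ.+ seq y n) (+-cauchy {seq x} {seq y} (cauchy x) (cauchy y))

_*_ : ℝ → ℝ → ℝ
x * y = mkℝ (λ n → seq x n ℚ.* seq y n) (*-cauchy {seq x} {seq y} (cauchy x) (cauchy y))

Matrix : ℕ → ℕ → Set
Matrix n m = Fin n → Fin m → ℝ

infix  4 _≃ᴹ_
infixl 7 _⊗_

_≃ᴹ_ : ∀ {n m} → Matrix n m → Matrix n m → Set
A ≃ᴹ B = ∀ i j → A i j ≃ B i j

sum : ∀ {r} → (Fin r → ℝ) → ℝ
sum = foldr _+_ 0ℝ

_⊗_ : ∀ {n r m} → Matrix n r → Matrix r m → Matrix n m
(U ⊗ V) i j = sum λ l → U i l * V l j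

IsNonnegative : ∀ {n m} → Matrix n m → Set
IsNonnegative A = ∀ i j → 0ℝ ≤ A i j

IsZeroOne : ∀ {n m} → Matrix n m → Set
IsZeroOne A = ∀ i j → A i j ≃ 0ℝ ⊎ A i j ≃ 1ℝ

HasNonnegativeFactorization : ∀ {n m} → Matrix n m → ℕ → Set
HasNonnegativeFactorization {n} {m} M r =
  ∃[ U ] ∃[ V ] IsNonnegative {n} {r} U × IsNonnegative {r} {m} V × M ≃ᴹ U ⊗ V

HasBinaryFactorization : ∀ {n m} → Matrix n m → ℕ → Set
HasBinaryFactorization {n} {m} M r =
  ∃[ U ] ∃[ V ] IsZeroOne {n} {r} U × IsZeroOne {r} {m} V × M ≃ᴹ U ⊗ V

IsLeast : (ℕ → Set) → ℕ → Set
IsLeast P r = P r × (∀ s → P s → r ℕ.≤ s)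

-- rank₊(M) = r and rank₀₁(M) = r.  These are relations because computing a
-- least element of a set of naturals is not constructive in general.

NonnegativeRank : ∀ {n m} → Matrix n m → ℕ → Set
NonnegativeRank M = IsLeast (HasNonnegativeFactorization M)

BinaryRank : ∀ {n m} → Matrix n m → ℕ → Set
BinaryRank M = IsLeast (HasBinaryFactorization M)

{-# OPTIONS --safe #-}

-- Take three classes of three cells each.  The columns of a block are the nine
-- cells and, for each class d, a column half d; the rows are the pairs of cells
-- within a class (pair) and certain transversals of the classes (triple).
-- The column half d is one half of the sum of the six cell columns outside
-- class d, so the block has nonnegative rank at most 9, and the pair rows contain
-- a fooling set of size 9.  A binary factorization is a partition of the ones
-- into rectangles ("tiles").  If there is a cell for which the tiles covering it in
-- its three triple rows all contain a second cell, these are three distinct tiles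
-- with cells of different classes, so none of the nine tiles of the fooling set.
-- Otherwise every cell has a tile containing no other cell; a parity argument on
-- the three pairs of a class shows that these nine tiles alone do not tile its
-- rows, and the three classes need three different further tiles.  So the block
-- has binary rank 12.  A tile, or a nonnegative rank-one term, cannot meet two
-- blocks of a block diagonal matrix, so q diagonal copies have ranks 9q and 12q.

module Submission where

open import Defs using (Matrix; IsZeroOne; NonnegativeRank; BinaryRank)
open import Data.Nat.Base using (ℕ; _*_; _/_; _<_)
open import Data.Nat.Divisibility using (_∣_)
open import Data.Product.Base using (Σ-syntax; ∃-syntax; _×_)

open import Defs using (ℝ; seq; cauchy; 0ℝ; 1ℝ; fromℚ; _≃_; sum; _⊗_; HasNonnegativeFactorization; HasBinaryFactorization)
open import Defs using (half-pos; half+half; eventually-bounded; ∣p*q∣<r*s; shrink)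
import Defs as Real
open import Data.Bool.Base using (Bool; true; false; T; not; _∧_; if_then_else_)
open import Data.Fin.Base using (Fin; zero; suc; splitAt; remQuot)
open import Data.Fin.Patterns using (0F; 1F; 2F)
open import Data.Fin.Properties using (_≟_; any?; all?; ¬∀⟶∃¬; suc-injective; *↔×; +↔⊎; injective⇒≤)
import Data.Integer.Base as ℤ
import Data.Nat.Base as ℕ
open import Data.Nat.DivMod using (m*n/n≡m)
open import Data.Nat.Divisibility using (divides)
import Data.Nat.Properties as ℕₚ
open import Data.Product.Base using (_,_; proj₁; proj₂; swap)
open import Data.Product.Function.NonDependent.Propositional using (_×-↔_)
open import Data.Rational.Base as ℚ using (ℚ; 0ℚ; 1ℚ; ½; ∣_∣)
import Data.Rational.Properties as ℚₚ
open import Data.Rational.Solver using (module +-*-Solver)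
open import Data.Sum.Base using (_⊎_; inj₁; inj₂; [_,_]′)
open import Data.Sum.Function.Propositional using (_⊎-↔_)
open import Data.Sum.Properties using ([,]-map; [,]-∘)
open import Data.Unit.Base using (tt)
open import Function.Base using (_∘_)
open import Function.Bundles using (_↔_; Inverse)
open import Function.Definitions using (Injective)
open import Function.Properties.Inverse using (↔-refl; ↔-trans)
open import Relation.Binary.PropositionalEquality using (_≡_; _≢_; refl; sym; trans; cong; cong₂; subst; subst₂)
open import Relation.Nullary using (¬_; Dec; yes; no; does; contradiction; ¬?)
open import Relation.Nullary.Decidable using (_×-dec_; _⊎-dec_; _→-dec_; decidable-stable; dec-true; dec-false; from-yes)
open import Algebra.Properties.Monoid.Sum ℚₚ.+-0-monoid using (sum-cong-≗; sum-replicate-zero) renaming (sum to ∑)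
open +-*-Solver using (solve; _:+_; _:-_; :-_; _:=_)

-- Positive reals and finite sums

p≤∣p∣ : ∀ p → p ℚ.≤ ∣ p ∣
p≤∣p∣ p with ℚₚ.≤-total 0ℚ p
... | inj₁ 0≤p = ℚₚ.≤-reflexive (sym (ℚₚ.0≤p⇒∣p∣≡p 0≤p))
... | inj₂ p≤0 = ℚₚ.≤-trans p≤0 (ℚₚ.0≤∣p∣ p)

∣p∣≤q : ∀ {p q} → ℚ.- q ℚ.≤ p → p ℚ.≤ q → ∣ p ∣ ℚ.≤ q
∣p∣≤q {p} {q} -q≤p p≤q with ℚₚ.∣p∣≡p∨∣p∣≡-p p
... | inj₁ eq = subst (ℚ._≤ q) (sym eq) p≤q
... | inj₂ eq = subst₂ ℚ._≤_ (sym eq) (-‿involutive q) (ℚₚ.neg-antimono-≤ -q≤p)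
  where
  -‿involutive : ∀ q → ℚ.- (ℚ.- q) ≡ q
  -‿involutive = solve 1 (λ q → :- (:- q) := q) refl

<⇒≱ : ∀ {p q} → p ℚ.< q → ¬ q ℚ.≤ p
<⇒≱ p<q q≤p = ℚₚ.<-irrefl refl (ℚₚ.<-≤-trans p<q q≤p)

+-cancelʳ-< : ∀ r {p q} → p ℚ.+ r ℚ.< q ℚ.+ r → p ℚ.< q
+-cancelʳ-< r p+r<q+r = ℚₚ.≰⇒> λ q≤p → <⇒≱ p+r<q+r (ℚₚ.+-monoˡ-≤ r q≤p)

p-q+q≡p : ∀ p q → (p ℚ.- q) ℚ.+ q ≡ p
p-q+q≡p = solve 2 (λ p q → (p :- q) :+ q := p) refl

∣p-q∣<r⇒p<q+r : ∀ p q {r} → ∣ p ℚ.- q ∣ ℚ.< r → p ℚ.< q ℚ.+ r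
∣p-q∣<r⇒p<q+r p q {r} h = subst₂ ℚ._<_ (p-q+q≡p p q) (ℚₚ.+-comm r q)
  (ℚₚ.+-monoˡ-< q (ℚₚ.≤-<-trans (p≤∣p∣ (p ℚ.- q)) h))

½*p<p : ∀ {p} → 0ℚ ℚ.< p → ½ ℚ.* p ℚ.< p
½*p<p {p} 0<p = subst₂ ℚ._<_ (ℚₚ.+-identityʳ (½ ℚ.* p)) (half+half p)
  (ℚₚ.+-monoʳ-< (½ ℚ.* p) (half-pos 0<p))

Eventually : (ℕ → Set) → Set
Eventually P = ∃[ N ] ∀ n → N ℕ.≤ n → P n

eventually₂ : ∀ {P Q R : ℕ → Set} → (∀ n → P n → Q n → R n) →
  Eventually P → Eventually Q → Eventually R
eventually₂ f (N₁ , p) (N₂ , q) = N₁ ℕ.⊔ N₂ , λ n N≤n →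
  f n (p n (ℕₚ.m⊔n≤o⇒m≤o N₁ N₂ N≤n)) (q n (ℕₚ.m⊔n≤o⇒n≤o N₁ N₂ N≤n))

≗⇒≃ : ∀ x y → (∀ n → seq x n ≡ seq y n) → x ≃ y
≗⇒≃ x y eq ε 0<ε = 0 , λ n _ → subst (ℚ._< ε)
  (sym (cong ∣_∣ (trans (cong (ℚ._- seq y n) (eq n)) (ℚₚ.+-inverseʳ (seq y n))))) 0<ε

≃-sym : ∀ {x y} → x ≃ y → y ≃ x
≃-sym {x} {y} x≃y ε 0<ε with x≃y ε 0<ε
... | N , h = N , λ n N≤n → subst (ℚ._< ε) (∣p-q∣≡∣q-p∣ (seq x n) (seq y n)) (h n N≤n)
  where
  ∣p-q∣≡∣q-p∣ : ∀ p q → ∣ p ℚ.- q ∣ ≡ ∣ q ℚ.- p ∣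
  ∣p-q∣≡∣q-p∣ p q = trans (sym (ℚₚ.∣-p∣≡∣p∣ (p ℚ.- q)))
    (cong ∣_∣ (solve 2 (λ p q → :- (p :- q) := q :- p) refl p q))

≃⇒≤ : ∀ {x y} → x ≃ y → x Real.≤ y
≃⇒≤ {x} {y} x≃y ε 0<ε with x≃y ε 0<ε
... | N , h = N , λ n N≤n → ∣p-q∣<r⇒p<q+r (seq x n) (seq y n) (h n N≤n)

≃⇒≥ : ∀ {x y} → x ≃ y → y Real.≤ x
≃⇒≥ {x} {y} x≃y = ≃⇒≤ {y} {x} (≃-sym {x} {y} x≃y)

fromℚ-mono-≤ : ∀ {p q} → p ℚ.≤ q → fromℚ p Real.≤ fromℚ q
fromℚ-mono-≤ {p} {q} p≤q ε 0<ε = 0 , λ _ _ →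
  subst (ℚ._< q ℚ.+ ε) (ℚₚ.+-identityʳ p) (ℚₚ.+-mono-≤-< p≤q 0<ε)

≤-refl : ∀ x → x Real.≤ x
≤-refl x = ≃⇒≤ {x} {x} (≗⇒≃ x x λ _ → refl)

≤-trans : ∀ x y z → x Real.≤ y → y Real.≤ z → x Real.≤ z
≤-trans x y z x≤y y≤z ε 0<ε = eventually₂ step (x≤y _ (half-pos 0<ε)) (y≤z _ (half-pos 0<ε))
  where
  step : ∀ n → seq x n ℚ.< seq y n ℚ.+ ½ ℚ.* ε → seq y n ℚ.< seq z n ℚ.+ ½ ℚ.* ε →
    seq x n ℚ.< seq z n ℚ.+ ε
  step n p q = ℚₚ.<-trans p (subst (seq y n ℚ.+ ½ ℚ.* ε ℚ.<_)
    (trans (ℚₚ.+-assoc (seq z n) (½ ℚ.* ε) (½ ℚ.* ε)) (cong (seq z n ℚ.+_) (half+half ε)))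
    (ℚₚ.+-monoˡ-< (½ ℚ.* ε) q))

+-mono-≤ : ∀ x y z w → x Real.≤ y → z Real.≤ w → x Real.+ z Real.≤ y Real.+ w
+-mono-≤ x y z w x≤y z≤w ε 0<ε = eventually₂ step (x≤y _ (half-pos 0<ε)) (z≤w _ (half-pos 0<ε))
  where
  interchange : ∀ a b h → (a ℚ.+ h) ℚ.+ (b ℚ.+ h) ≡ (a ℚ.+ b) ℚ.+ (h ℚ.+ h)
  interchange = solve 3 (λ a b h → (a :+ h) :+ (b :+ h) := (a :+ b) :+ (h :+ h)) refl
  step : ∀ n → seq x n ℚ.< seq y n ℚ.+ ½ ℚ.* ε → seq z n ℚ.< seq w n ℚ.+ ½ ℚ.* ε →
    seq x n ℚ.+ seq z n ℚ.< seq y n ℚ.+ seq w n ℚ.+ ε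
  step n p q = subst (seq x n ℚ.+ seq z n ℚ.<_)
    (trans (interchange (seq y n) (seq w n) (½ ℚ.* ε))
      (cong (seq y n ℚ.+ seq w n ℚ.+_) (half+half ε)))
    (ℚₚ.+-mono-< p q)

infix 4 _≺_

_≺_ : ℚ → ℝ → Set
q ≺ x = Eventually λ n → q ℚ.< seq x n

-- Termwise, `x ≤ y` holds only up to an arbitrarily small rational error; the gap `q - p` pays for
-- it.
≺-≤-trans : ∀ {p q} x y → p ℚ.< q → q ≺ x → x Real.≤ y → p ≺ y
≺-≤-trans {p} {q} x y p<q q≺x x≤y = eventually₂ step q≺x (x≤y (q ℚ.- p) 0<q-p)
  where
  0<q-p : 0ℚ ℚ.< q ℚ.- p
  0<q-p = subst (ℚ._< q ℚ.- p) (ℚₚ.+-inverseʳ p) (ℚₚ.+-monoˡ-< (ℚ.- p) p<q)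
  step : ∀ n → q ℚ.< seq x n → seq x n ℚ.< seq y n ℚ.+ (q ℚ.- p) → p ℚ.< seq y n
  step n q<x x<y = +-cancelʳ-< (q ℚ.- p) (subst (ℚ._< seq y n ℚ.+ (q ℚ.- p))
    (trans (sym (p-q+q≡p q p)) (ℚₚ.+-comm (q ℚ.- p) p)) (ℚₚ.<-trans q<x x<y))

≺-+ : ∀ {p q} x y → p ≺ x → q ≺ y → p ℚ.+ q ≺ x Real.+ y
≺-+ x y = eventually₂ λ _ → ℚₚ.+-mono-<

≺-* : ∀ {p q} x y → 0ℚ ℚ.< p → 0ℚ ℚ.< q → p ≺ x → q ≺ y → p ℚ.* q ≺ x Real.* y
≺-* {p} {q} x y 0<p 0<q = eventually₂ λ n p<x q<y → ℚₚ.<-trans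
  (ℚₚ.*-monoˡ-<-pos q {{ℚ.positive 0<q}} p<x)
  (ℚₚ.*-monoʳ-<-pos (seq x n) {{ℚ.positive (ℚₚ.<-trans 0<p p<x)}} q<y)

-- A rational lower bound is demanded because eventual positivity of the terms is not enough: the
-- sequence `1/(n+1)` has positive terms and represents zero.
Positive : ℝ → Set
Positive x = ∃[ q ] 0ℚ ℚ.< q × q ≺ x

positive-≤ : ∀ x y → Positive x → x Real.≤ y → Positive y
positive-≤ x y (q , 0<q , q≺x) x≤y =
  ½ ℚ.* q , half-pos 0<q , ≺-≤-trans x y (½*p<p 0<q) q≺x x≤y

positive-* : ∀ x y → Positive x → Positive y → Positive (x Real.* y)
positive-* x y (p , 0<p , p≺x) (q , 0<q , q≺y) = p ℚ.* q
  , ℚₚ.positive⁻¹ (p ℚ.* q) {{ℚₚ.pos*pos⇒pos p {{ℚ.positive 0<p}} q {{ℚ.positive 0<q}}}}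
  , ≺-* x y 0<p 0<q p≺x q≺y

positive-1 : Positive 1ℝ
positive-1 = ½ , ℚₚ.positive⁻¹ ½ , 0 , λ _ _ → ½*p<p {1ℚ} (ℚₚ.positive⁻¹ 1ℚ)

¬positive-0 : ¬ Positive 0ℝ
¬positive-0 (q , 0<q , N , h) = ℚₚ.<-asym 0<q (h N ℕₚ.≤-refl)

positive-from-index : ∀ x {h} N → 0ℚ ℚ.< h → h ℚ.< seq x N →
  (∀ n → N ℕ.≤ n → ∣ seq x N ℚ.- seq x n ∣ ℚ.< ½ ℚ.* h) → Positive x
positive-from-index x {h} N 0<h h<x near = ½ ℚ.* h , half-pos 0<h , N , λ n N≤n →
  +-cancelʳ-< (½ ℚ.* h) (subst (ℚ._< seq x n ℚ.+ ½ ℚ.* h) (sym (half+half h))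
    (ℚₚ.<-trans h<x (∣p-q∣<r⇒p<q+r (seq x N) (seq x n) (near n N≤n))))

-- Constructively the summand is chosen by comparing the two at a single index
-- beyond which both sequences vary by less than q / 4.
positive-+⁻ : ∀ x y → Positive (x Real.+ y) → Positive x ⊎ Positive y
positive-+⁻ x y (q , 0<q , N , q<x+y) =
  choose (cauchy x _ (half-pos (half-pos 0<q))) (cauchy y _ (half-pos (half-pos 0<q)))
  where
  ε : ℚ
  ε = ½ ℚ.* (½ ℚ.* q)
  choose :
    (∃[ N₁ ] ∀ m n → N₁ ℕ.≤ m → N₁ ℕ.≤ n → ∣ seq x m ℚ.- seq x n ∣ ℚ.< ε) →
    (∃[ N₂ ] ∀ m n → N₂ ℕ.≤ m → N₂ ℕ.≤ n → ∣ seq y m ℚ.- seq y n ∣ ℚ.< ε) →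
    Positive x ⊎ Positive y
  choose (N₁ , cx) (N₂ , cy) with ½ ℚ.* q ℚₚ.<? seq x (N ℕ.⊔ (N₁ ℕ.⊔ N₂))
  ... | yes h<x = inj₁ (positive-from-index x _ (half-pos 0<q) h<x λ n N≤n → cx _ n
    (ℕₚ.m⊔n≤o⇒m≤o N₁ N₂ (ℕₚ.m≤n⊔m N (N₁ ℕ.⊔ N₂)))
    (ℕₚ.m⊔n≤o⇒m≤o N₁ N₂ (ℕₚ.m⊔n≤o⇒n≤o N (N₁ ℕ.⊔ N₂) N≤n)))
  ... | no h≮x = inj₂ (positive-from-index y _ (half-pos 0<q) h<y λ n N≤n → cy _ n
    (ℕₚ.m⊔n≤o⇒n≤o N₁ N₂ (ℕₚ.m≤n⊔m N (N₁ ℕ.⊔ N₂)))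
    (ℕₚ.m⊔n≤o⇒n≤o N₁ N₂ (ℕₚ.m⊔n≤o⇒n≤o N (N₁ ℕ.⊔ N₂) N≤n)))
    where
    h<y : ½ ℚ.* q ℚ.< seq y (N ℕ.⊔ (N₁ ℕ.⊔ N₂))
    h<y = ℚₚ.≰⇒> λ y≤h → <⇒≱ (q<x+y _ (ℕₚ.m≤m⊔n N (N₁ ℕ.⊔ N₂)))
      (ℚₚ.≤-trans (ℚₚ.+-mono-≤ (ℚₚ.≮⇒≥ h≮x) y≤h) (ℚₚ.≤-reflexive (half+half q)))

-- Eventually `∣ y ∣ ≤ B`. With `B * δ ≡ q`, a value of `x` between `-δ` and `δ` gives a product of
-- at most `q`, and nonnegativity of `x` excludes values below `-δ`. Hence `δ` is a lower bound for
-- `x`.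
positive-*⁻ˡ : ∀ x y → 0ℝ Real.≤ x → Positive (x Real.* y) → Positive x
positive-*⁻ˡ x y 0≤x (q , 0<q , q≺xy) = bound (eventually-bounded {seq y} (cauchy y))
  where
  bound : (∃[ B ] 0ℚ ℚ.< B × (∃[ N ] ∀ n → N ℕ.≤ n → ∣ seq y n ∣ ℚ.≤ B)) → Positive x
  bound (B , 0<B , y≤B) = scale (shrink B q 0<B 0<q)
    where
    scale : (∃[ δ ] 0ℚ ℚ.< δ × B ℚ.* δ ≡ q) → Positive x
    scale (δ , 0<δ , Bδ≡q) =
      δ , 0<δ , eventually₂ (λ n (q<xy , y≤B) 0<x+δ → ℚₚ.≰⇒> λ x≤δ → <⇒≱ q<xy
        (xy≤q (∣p∣≤q (-δ≤x 0<x+δ) x≤δ) y≤B))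
        (eventually₂ (λ _ → _,_) q≺xy y≤B) (0≤x δ 0<δ)
      where
      open ℚₚ.≤-Reasoning
      -δ≤x : ∀ {a} → 0ℚ ℚ.< a ℚ.+ δ → ℚ.- δ ℚ.≤ a
      -δ≤x {a} 0<a+δ = ℚₚ.<⇒≤ (+-cancelʳ-< δ
        (subst (ℚ._< a ℚ.+ δ) (sym (ℚₚ.+-inverseˡ δ)) 0<a+δ))
      xy≤q : ∀ {a b} → ∣ a ∣ ℚ.≤ δ → ∣ b ∣ ℚ.≤ B → a ℚ.* b ℚ.≤ q
      xy≤q {a} {b} a≤δ b≤B = begin
        a ℚ.* b          ≤⟨ p≤∣p∣ (a ℚ.* b) ⟩
        ∣ a ℚ.* b ∣      ≡⟨ ℚₚ.∣p*q∣≡∣p∣*∣q∣ a b ⟩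
        ∣ a ∣ ℚ.* ∣ b ∣  ≤⟨ ℚₚ.*-monoʳ-≤-nonNeg ∣ b ∣ {{ℚ.nonNegative (ℚₚ.0≤∣p∣ b)}} a≤δ ⟩
        δ ℚ.* ∣ b ∣      ≤⟨ ℚₚ.*-monoˡ-≤-nonNeg δ {{ℚ.nonNegative (ℚₚ.<⇒≤ 0<δ)}} b≤B ⟩
        δ ℚ.* B          ≡⟨ ℚₚ.*-comm δ B ⟩
        B ℚ.* δ          ≡⟨ Bδ≡q ⟩
        q                ∎

positive-*⁻ʳ : ∀ x y → 0ℝ Real.≤ y → Positive (x Real.* y) → Positive y
positive-*⁻ʳ x y 0≤y xy>0 = positive-*⁻ˡ y x 0≤y
  (positive-≤ (x Real.* y) (y Real.* x) xy>0 (≃⇒≤ {x Real.* y} {y Real.* x}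
    (≗⇒≃ (x Real.* y) (y Real.* x) λ n → ℚₚ.*-comm (seq x n) (seq y n))))

-- Terms of a nonnegative real may be slightly negative. A negative term has absolute value below
-- `δ` and the other factor is bounded, so the product stays above `-ε`. Taking `(A + B) * δ ≡ ε`
-- serves both factors at once.
*-nonneg : ∀ x y → 0ℝ Real.≤ x → 0ℝ Real.≤ y → 0ℝ Real.≤ x Real.* y
*-nonneg x y 0≤x 0≤y ε 0<ε =
  bound (eventually-bounded {seq x} (cauchy x)) (eventually-bounded {seq y} (cauchy y))
  where
  ∣p∣<ε⇒0<p+ε : ∀ p → ∣ p ∣ ℚ.< ε → 0ℚ ℚ.< p ℚ.+ ε
  ∣p∣<ε⇒0<p+ε p h = ∣p-q∣<r⇒p<q+r 0ℚ p
    (subst (ℚ._< ε) (trans (sym (ℚₚ.∣-p∣≡∣p∣ p)) (cong ∣_∣ (sym (ℚₚ.+-identityˡ (ℚ.- p))))) h)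

  ∣a∣<δ : ∀ {a δ} → a ℚ.< 0ℚ → 0ℚ ℚ.< a ℚ.+ δ → ∣ a ∣ ℚ.< δ
  ∣a∣<δ {a} {δ} a<0 0<a+δ with ℚₚ.∣p∣≡p∨∣p∣≡-p a
  ... | inj₁ eq = contradiction (ℚₚ.∣p∣≡p⇒0≤p eq) (<⇒≱ a<0)
  ... | inj₂ eq = subst (ℚ._< δ) (sym eq) (+-cancelʳ-< a
    (subst₂ ℚ._<_ (sym (ℚₚ.+-inverseˡ a)) (ℚₚ.+-comm a δ) 0<a+δ))

  product : ∀ {A B δ} a b → 0ℚ ℚ.< A → 0ℚ ℚ.< B → (A ℚ.+ B) ℚ.* δ ≡ ε →
    ∣ a ∣ ℚ.≤ A → ∣ b ∣ ℚ.≤ B → 0ℚ ℚ.< a ℚ.+ δ → 0ℚ ℚ.< b ℚ.+ δ → 0ℚ ℚ.< a ℚ.* b ℚ.+ ε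
  product {A} {B} a b 0<A 0<B eq a≤A b≤B 0<a+δ 0<b+δ with a ℚₚ.<? 0ℚ | b ℚₚ.<? 0ℚ
  ... | yes a<0 | _ = ∣p∣<ε⇒0<p+ε (a ℚ.* b) (subst₂ ℚ._<_ (cong ∣_∣ (ℚₚ.*-comm b a)) eq
    (∣p*q∣<r*s b a (ℚₚ.+-mono-< {0ℚ} {A} {0ℚ} {B} 0<A 0<B)
      (ℚₚ.≤-trans b≤B (subst (ℚ._≤ A ℚ.+ B) (ℚₚ.+-identityˡ B) (ℚₚ.+-monoˡ-≤ B (ℚₚ.<⇒≤ 0<A))))
      (∣a∣<δ a<0 0<a+δ)))
  ... | no _ | yes b<0 = ∣p∣<ε⇒0<p+ε (a ℚ.* b) (subst (∣ a ℚ.* b ∣ ℚ.<_) eq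
    (∣p*q∣<r*s a b (ℚₚ.+-mono-< {0ℚ} {A} {0ℚ} {B} 0<A 0<B)
      (ℚₚ.≤-trans a≤A (subst (ℚ._≤ A ℚ.+ B) (ℚₚ.+-identityʳ A) (ℚₚ.+-monoʳ-≤ A (ℚₚ.<⇒≤ 0<B))))
      (∣a∣<δ b<0 0<b+δ)))
  ... | no a≮0 | no b≮0 = ℚₚ.+-mono-≤-< {0ℚ} {a ℚ.* b} {0ℚ} {ε} (ℚₚ.nonNegative⁻¹ (a ℚ.* b)
    {{ℚₚ.nonNeg*nonNeg⇒nonNeg a {{ℚ.nonNegative (ℚₚ.≮⇒≥ a≮0)}} b {{ℚ.nonNegative (ℚₚ.≮⇒≥ b≮0)}}}}) 0<ε

  bound :
    (∃[ A ] 0ℚ ℚ.< A × (∃[ N ] ∀ n → N ℕ.≤ n → ∣ seq x n ∣ ℚ.≤ A)) →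
    (∃[ B ] 0ℚ ℚ.< B × (∃[ N ] ∀ n → N ℕ.≤ n → ∣ seq y n ∣ ℚ.≤ B)) →
    Eventually λ n → 0ℚ ℚ.< seq x n ℚ.* seq y n ℚ.+ ε
  bound (A , 0<A , x≤A) (B , 0<B , y≤B) =
    scale (shrink (A ℚ.+ B) ε (ℚₚ.+-mono-< {0ℚ} {A} {0ℚ} {B} 0<A 0<B) 0<ε)
    where
    scale : (∃[ δ ] 0ℚ ℚ.< δ × (A ℚ.+ B) ℚ.* δ ≡ ε) →
      Eventually λ n → 0ℚ ℚ.< seq x n ℚ.* seq y n ℚ.+ ε
    scale (δ , 0<δ , eq) = eventually₂
      (λ n (a≤A , b≤B) (0<a+δ , 0<b+δ) → product (seq x n) (seq y n) 0<A 0<B eq a≤A b≤B 0<a+δ 0<b+δ)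
      (eventually₂ (λ _ → _,_) x≤A y≤B) (eventually₂ (λ _ → _,_) (0≤x δ 0<δ) (0≤y δ 0<δ))

positive-sum⁻ : ∀ {r} (f : Fin r → ℝ) → Positive (sum f) → ∃[ l ] Positive (f l)
positive-sum⁻ {ℕ.zero} f p = contradiction p ¬positive-0
positive-sum⁻ {ℕ.suc r} f p =
  [ (zero ,_) , (λ p₊ → let l , pₗ = positive-sum⁻ (f ∘ suc) p₊ in suc l , pₗ) ]′
    (positive-+⁻ (f zero) (sum (f ∘ suc)) p)

≤-+ˡ : ∀ x y z → x Real.≤ y → 0ℝ Real.≤ z → x Real.≤ z Real.+ y
≤-+ˡ x y z x≤y 0≤z = ≤-trans x (0ℝ Real.+ x) (z Real.+ y)
  (≃⇒≤ {x} {0ℝ Real.+ x} (≗⇒≃ x (0ℝ Real.+ x) λ n → sym (ℚₚ.+-identityˡ (seq x n))))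
  (+-mono-≤ 0ℝ z x y 0≤z x≤y)

sum-nonneg : ∀ {r} (f : Fin r → ℝ) → (∀ l → 0ℝ Real.≤ f l) → 0ℝ Real.≤ sum f
sum-nonneg {ℕ.zero} f 0≤f = ≤-refl 0ℝ
sum-nonneg {ℕ.suc r} f 0≤f =
  ≤-+ˡ 0ℝ (sum (f ∘ suc)) (f zero) (sum-nonneg (f ∘ suc) (0≤f ∘ suc)) (0≤f zero)

≤-+ʳ : ∀ x y → 0ℝ Real.≤ y → x Real.≤ x Real.+ y
≤-+ʳ x y 0≤y = ≤-trans x (x Real.+ 0ℝ) (x Real.+ y)
  (≃⇒≤ {x} {x Real.+ 0ℝ} (≗⇒≃ x (x Real.+ 0ℝ) λ n → sym (ℚₚ.+-identityʳ (seq x n))))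
  (+-mono-≤ x x 0ℝ y (≤-refl x) 0≤y)

term≤sum : ∀ {r} (f : Fin r → ℝ) → (∀ l → 0ℝ Real.≤ f l) → ∀ l → f l Real.≤ sum f
term≤sum f 0≤f zero = ≤-+ʳ (f zero) (sum (f ∘ suc)) (sum-nonneg (f ∘ suc) (0≤f ∘ suc))
term≤sum f 0≤f (suc l) =
  ≤-+ˡ (f (suc l)) (sum (f ∘ suc)) (f zero) (term≤sum (f ∘ suc) (0≤f ∘ suc) l) (0≤f zero)

terms≤sum : ∀ {r} (f : Fin r → ℝ) → (∀ l → 0ℝ Real.≤ f l) →
  ∀ l l′ → l ≢ l′ → f l Real.+ f l′ Real.≤ sum f
terms≤sum f 0≤f zero zero l≢l′ = contradiction refl l≢l′
terms≤sum f 0≤f zero (suc l′) _ =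
  +-mono-≤ (f zero) (f zero) (f (suc l′)) (sum (f ∘ suc)) (≤-refl (f zero))
    (term≤sum (f ∘ suc) (0≤f ∘ suc) l′)
terms≤sum f 0≤f (suc l) zero _ = ≤-trans (f (suc l) Real.+ f zero) (f zero Real.+ f (suc l)) (sum f)
  (≃⇒≤ {f (suc l) Real.+ f zero} {f zero Real.+ f (suc l)}
    (≗⇒≃ (f (suc l) Real.+ f zero) (f zero Real.+ f (suc l))
      λ n → ℚₚ.+-comm (seq (f (suc l)) n) (seq (f zero) n)))
  (terms≤sum f 0≤f zero (suc l) λ ())
terms≤sum f 0≤f (suc l) (suc l′) l≢l′ =
  ≤-+ˡ (f (suc l) Real.+ f (suc l′)) (sum (f ∘ suc)) (f zero)
    (terms≤sum (f ∘ suc) (0≤f ∘ suc) l l′ (l≢l′ ∘ cong suc)) (0≤f zero)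

-- Covers and tilings by rectangles

-- Each index is a combinatorial rectangle of ones, which keeps only the zero pattern of a rank-one
-- term. Rectangles may overlap or be empty.
record Cover {X Y : Set} (M : X → Y → Bool) (s : ℕ) : Set₁ where
  field
    _∈ʳ_   : X → Fin s → Set
    _∈ᶜ_   : Y → Fin s → Set
    covers : ∀ x y → T (M x y) → ∃[ l ] x ∈ʳ l × y ∈ᶜ l
    sound  : ∀ {x y l} → x ∈ʳ l → y ∈ᶜ l → T (M x y)

  Inhabited : Fin s → Set
  Inhabited l = (∃[ x ] x ∈ʳ l) × (∃[ y ] y ∈ᶜ l)

record Tiling {X Y : Set} (M : X → Y → Bool) (s : ℕ) : Set₁ where
  field
    cover    : Cover M s
  open Cover cover public
  field
    -- Deciding column membership makes the case split on crowded tiles constructive.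
    _∈ᶜ?_    : ∀ y l → Dec (y ∈ᶜ l)
    disjoint : ∀ {x y l l′} → x ∈ʳ l → y ∈ᶜ l → x ∈ʳ l′ → y ∈ᶜ l′ → l ≡ l′

restrict : ∀ {X Y X′ Y′ s} {M : X → Y → Bool} {M′ : X′ → Y′ → Bool}
  (f : X′ → X) (g : Y′ → Y) → (∀ x y → M (f x) (g y) ≡ M′ x y) → Cover M s → Cover M′ s
restrict f g eq C = record
  { _∈ʳ_   = λ x l → f x ∈ʳ l
  ; _∈ᶜ_   = λ y l → g y ∈ᶜ l
  ; covers = λ x y → covers (f x) (g y) ∘ subst T (sym (eq x y))
  ; sound  = λ {x} {y} p q → subst T (eq x y) (sound p q)
  }
  where open Cover C

restrictTiling : ∀ {X Y X′ Y′ s} {M : X → Y → Bool} {M′ : X′ → Y′ → Bool}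
  (f : X′ → X) (g : Y′ → Y) → (∀ x y → M (f x) (g y) ≡ M′ x y) → Tiling M s → Tiling M′ s
restrictTiling f g eq C = record
  { cover    = restrict f g eq cover
  ; _∈ᶜ?_    = λ y l → g y ∈ᶜ? l
  ; disjoint = disjoint
  }
  where open Tiling C

-- A tile is a rectangle, so one shared by the chosen entries of `i` and `j` also contains the two
-- crossed entries. Both are then ones, which forces `i ≡ j`.
fooling : ∀ {A X Y : Set} {M : X → Y → Bool} {s} (a : A → X) (b : A → Y) →
  (on : ∀ i → T (M (a i) (b i))) →
  (∀ i j → T (M (a i) (b j)) → T (M (a j) (b i)) → i ≡ j) →
  (C : Cover M s) → Injective _≡_ _≡_ (λ i → proj₁ (Cover.covers C (a i) (b i) (on i)))
fooling a b on off C {i} {j} eq = off i j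
  (sound (row i) (subst (b j ∈ᶜ_) (sym eq) (col j)))
  (sound (row j) (subst (b i ∈ᶜ_) eq (col i)))
  where
  open Cover C
  row : ∀ i → a i ∈ʳ proj₁ (covers (a i) (b i) (on i))
  row i = proj₁ (proj₂ (covers (a i) (b i) (on i)))
  col : ∀ i → b i ∈ᶜ proj₁ (covers (a i) (b i) (on i))
  col i = proj₂ (proj₂ (covers (a i) (b i) (on i)))

-- Combines finitely many searches: a single success of type `A` ends the argument, otherwise every
-- index contributes its `P i`.
⊎-all : ∀ {n} {A : Set} {P : Fin n → Set} → (∀ i → A ⊎ P i) → A ⊎ (∀ i → P i)
⊎-all {ℕ.zero} h = inj₂ λ ()
⊎-all {ℕ.suc n} h with h zero | ⊎-all (h ∘ suc)
... | inj₁ a  | _       = inj₁ a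
... | inj₂ _  | inj₁ a  = inj₁ a
... | inj₂ p₀ | inj₂ p₊ = inj₂ λ { zero → p₀ ; (suc i) → p₊ i }

-- The block and its fooling set

Cell Row Col : Set
Cell = Fin 3 × Fin 3
Row = Cell ⊎ Fin 3 × Fin 3 × Fin 3
Col = Cell ⊎ Fin 3

pattern pair c i = inj₁ (c , i)
pattern triple c i j = inj₂ (c , i , j)
pattern cell c i = inj₁ (c , i)
pattern half d = inj₂ d

-- `pair c i` is the pair of class `c` that omits cell `i`. The entry at `half d` is half the number
-- of cells of the row outside class `d`: none or two for a pair, always two for a triple. The rows
-- `triple c i i` coincide for all `c`.
entry : Row → Col → Bool
entry (pair c i)     (cell d k) = does (c ≟ d) ∧ not (does (i ≟ k))
entry (pair c i)     (half d)   = not (does (c ≟ d))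
entry (triple c i j) (cell d k) = if does (c ≟ d) then does (i ≟ k) else does (j ≟ k)
entry (triple c i j) (half d)   = true

next : Fin 3 → Fin 3
next 0F = 1F
next 1F = 2F
next 2F = 0F

pair-cell⁻ : ∀ c i d k → T (entry (pair c i) (cell d k)) → c ≡ d × i ≢ k
pair-cell⁻ c i d k p with c ≟ d | i ≟ k
... | yes c≡d | no i≢k = c≡d , i≢k

pair-cell : ∀ c i k → i ≢ k → T (entry (pair c i) (cell c k))
pair-cell c i k i≢k with c ≟ c | i ≟ k
... | yes _  | no _    = tt
... | yes _  | yes i≡k = i≢k i≡k
... | no c≢c | _       = c≢c refl

pair-half⁻ : ∀ c i d → T (entry (pair c i) (half d)) → c ≢ d
pair-half⁻ c i d p with c ≟ d
... | no c≢d = c≢d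

pair-half : ∀ c i → T (entry (pair c i) (half (next c)))
pair-half 0F i = tt
pair-half 1F i = tt
pair-half 2F i = tt

triple-own : ∀ c i j → T (entry (triple c i j) (cell c i))
triple-own c i j with c ≟ c | i ≟ i
... | yes _  | yes _  = tt
... | yes _  | no i≢i = i≢i refl
... | no c≢c | _      = contradiction refl c≢c

triple-own⁻ : ∀ c i j k → T (entry (triple c i j) (cell c k)) → i ≡ k
triple-own⁻ c i j k p with c ≟ c | i ≟ k
... | yes _  | yes i≡k = i≡k
... | no c≢c | _       = contradiction refl c≢c

triple-other⁻ : ∀ c i j d k → c ≢ d → T (entry (triple c i j) (cell d k)) → j ≡ k
triple-other⁻ c i j d k c≢d p with c ≟ d | j ≟ k
... | no _    | yes j≡k = j≡k
... | yes c≡d | _       = contradiction c≡d c≢d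

i≢next : ∀ i → i ≢ next i
i≢next 0F ()
i≢next 1F ()
i≢next 2F ()

abstract
  next-cases : ∀ {c d} → c ≢ d → d ≡ next c ⊎ c ≡ next d
  next-cases {c} {d} = from-yes (all? λ c → all? λ d →
    ¬? (c ≟ d) →-dec ((d ≟ next c) ⊎-dec (c ≟ next d))) c d

  third : ∀ (k k′ : Fin 3) → ∃[ i ] i ≢ k × i ≢ k′
  third = from-yes (all? {3} λ k → all? λ k′ → any? λ i → ¬? (i ≟ k) ×-dec ¬? (i ≟ k′))

pair-on : ((c , i) : Cell) → T (entry (pair c i) (cell c (next i)))
pair-on (c , i) = pair-cell c i (next i) (i≢next i)

-- A pair row has cells of one class only. Distinct positions among three are cyclic neighbours, so
-- for `i ≢ k` one of the two rows would have to contain the cell that it omits.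
pair-off : ((c , i) (d , k) : Cell) → T (entry (pair c i) (cell d (next k))) →
  T (entry (pair d k) (cell c (next i))) → (c , i) ≡ (d , k)
pair-off (c , i) (d , k) p q with i ≟ k
... | yes i≡k = cong₂ _,_ (proj₁ (pair-cell⁻ c i d (next k) p)) i≡k
... | no i≢k with next-cases i≢k
...   | inj₁ k≡i′ = contradiction k≡i′ (proj₂ (pair-cell⁻ d k c (next i) q))
...   | inj₂ i≡k′ = contradiction i≡k′ (proj₂ (pair-cell⁻ c i d (next k) p))

-- Twelve tiles in every tiling of the block

module _ {s : ℕ} (t : Tiling entry s) where
  open Tiling t

  -- `Col` serves as a set of twelve labels. Inhabitedness later keeps the tiles of different
  -- diagonal blocks apart.
  Bound : Set
  Bound = Σ[ f ∈ (Col → Fin s) ] Injective _≡_ _≡_ f × (∀ y → Inhabited (f y))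

  lead : Fin 3 → Fin 3 → Fin 3 → Fin s
  lead c i j = proj₁ (covers (triple c i j) (cell c i) (triple-own c i j))

  lead-row : ∀ c i j → triple c i j ∈ʳ lead c i j
  lead-row c i j = proj₁ (proj₂ (covers (triple c i j) (cell c i) (triple-own c i j)))

  lead-cell : ∀ c i j → cell c i ∈ᶜ lead c i j
  lead-cell c i j = proj₂ (proj₂ (covers (triple c i j) (cell c i) (triple-own c i j)))

  -- A triple row has one cell in each class, so a cell of the lead tile other than `cell c i` must
  -- lie in another class.
  Crowded : Fin 3 → Fin 3 → Fin 3 → Set
  Crowded c i j = ∃[ d ] ∃[ k ] c ≢ d × cell d k ∈ᶜ lead c i j

  crowded? : ∀ c i j → Dec (Crowded c i j)
  crowded? c i j = any? λ d → any? λ k → ¬? (c ≟ d) ×-dec (cell d k ∈ᶜ? lead c i j)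

  crowded-bound : ∀ c i → (∀ j → Crowded c i j) → Bound
  crowded-bound c i crowd = f , injective , inhabited
    where
    covering : ((c , i) : Cell) → ∃[ l ] pair c i ∈ʳ l × cell c (next i) ∈ᶜ l
    covering e@(c , i) = covers (pair c i) (cell c (next i)) (pair-on e)

    g : Cell → Fin s
    g e = proj₁ (covering e)

    f : Col → Fin s
    f (inj₁ e) = g e
    -- As a label, `j` is here the index of a cell and not a class.
    f (half j) = lead c i j

    g≢lead : ∀ e j → g e ≢ lead c i j
    g≢lead (d , k) j eq with crowd j
    -- A tile through a pair row has cells of one class only, but this one would have cells of the
    -- classes `c` and `d′`.
    ... | d′ , k′ , c≢d′ , other = c≢d′ (trans
      (sym (proj₁ (pair-cell⁻ d k c i (sound row (subst (cell c i ∈ᶜ_) (sym eq) (lead-cell c i j))))))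
      (proj₁ (pair-cell⁻ d k d′ k′ (sound row (subst (cell d′ k′ ∈ᶜ_) (sym eq) other)))))
      where
      row : pair d k ∈ʳ g (d , k)
      row = proj₁ (proj₂ (covering (d , k)))

    injective : Injective _≡_ _≡_ f
    injective {inj₁ e} {inj₁ e′} eq = cong inj₁
      (fooling (λ (c , i) → pair c i) (λ (c , i) → cell c (next i)) pair-on pair-off cover eq)
    injective {inj₁ e} {half j} eq = contradiction eq (g≢lead e j)
    injective {half j} {inj₁ e} eq = contradiction (sym eq) (g≢lead e j)
    injective {half j} {half j′} eq with crowd j
    -- Outside class `c`, the cells of `triple c i j` have index `j`. A cell there that belongs to
    -- both tiles forces `j` and `j′` to equal `k`.
    ... | d , k , c≢d , other = cong inj₂ (trans
      (triple-other⁻ c i j d k c≢d (sound (lead-row c i j) other))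
      (sym (triple-other⁻ c i j′ d k c≢d (sound (lead-row c i j′) (subst (cell d k ∈ᶜ_) eq other)))))

    inhabited : ∀ y → Inhabited (f y)
    inhabited (inj₁ e) =
      (_ , proj₁ (proj₂ (covering e))) , (_ , proj₂ (proj₂ (covering e)))
    inhabited (half j) = (_ , lead-row c i j) , (_ , lead-cell c i j)

  module _ (lone : ∀ c i → ∃[ j ] ¬ Crowded c i j) where

    w : Cell → Fin s
    w (c , i) = lead c i (proj₁ (lone c i))

    w-cell : ∀ c i → cell c i ∈ᶜ w (c , i)
    w-cell c i = lead-cell c i _

    -- Within class `c` the triple row contains only cell `i`, and a cell of another class would
    -- make the tile crowded, against the choice made by `lone`. In particular `w` is injective.
    w-only : ∀ {c i d k} → cell d k ∈ᶜ w (c , i) → (c , i) ≡ (d , k)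
    w-only {c} {i} {d} {k} d∈w with c ≟ d
    ... | yes refl = cong (c ,_) (triple-own⁻ c i (proj₁ (lone c i)) k (sound (lead-row c i _) d∈w))
    ... | no c≢d = contradiction (d , k , c≢d , d∈w) (proj₂ (lone c i))

    record Extra (c : Fin 3) : Set where
      constructor extra
      field
        {tile} : Fin s
        {miss} : Fin 3
        row    : pair c miss ∈ʳ tile
        col    : half (next c) ∈ᶜ tile ⊎ ∃[ k ] cell c k ∈ᶜ tile
        new    : ∀ e → tile ≢ w e
    open Extra

    cell-tile : ∀ c i k → Extra c ⊎ (i ≢ k → pair c i ∈ʳ w (c , k))
    cell-tile c i k with i ≟ k
    ... | yes i≡k = inj₂ (contradiction i≡k)
    ... | no i≢k with covers (pair c i) (cell c k) (pair-cell c i k i≢k)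
    ...   | l , row , col with l ≟ w (c , k)
    ...     | yes refl = inj₂ λ _ → row
    -- Among the tiles `w e`, only `w (c , k)` contains `cell c k`, so `l` differs from all of them.
    ...     | no l≢w = inj₁ (extra row (inj₂ (k , col)) λ e l≡we →
      l≢w (trans l≡we (cong w (w-only (subst (cell c k ∈ᶜ_) l≡we col)))))

    half-tile : ∀ c i → Extra c ⊎ ∃[ k ] i ≢ k × half (next c) ∈ᶜ w (c , k)
    half-tile c i with covers (pair c i) (half (next c)) (pair-half c i)
    ... | l , row , col with any? (λ d → any? λ k → l ≟ w (d , k))
    ...   | no l≢w = inj₁ (extra row (inj₁ col) λ (d , k) l≡w → l≢w (d , k , l≡w))
    -- The tile `w (d , k)` also contains `cell d k`, so this cell belongs to the row `pair c i`.
    ...   | yes (d , k , refl) with pair-cell⁻ c i d k (sound row (w-cell d k))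
    ...     | refl , i≢k = inj₂ (k , i≢k , col)

    -- Without an extra tile, pair c i would be tiled by w (c , k) and w (c , k′)
    -- with {i, k, k′} = {0, 1, 2}, so exactly one of any two of the three tiles
    -- w (c , 0), w (c , 1), w (c , 2) would contain half (next c).
    extra-tile : ∀ c → Extra c
    extra-tile c with ⊎-all (λ i → ⊎-all (cell-tile c i)) | ⊎-all (half-tile c)
    ... | inj₁ E    | _      = E
    ... | inj₂ _    | inj₁ E = E
    ... | inj₂ rows | inj₂ halves with halves 0F
    ...   | k , _ , h with halves k
    ...     | k′ , k≢k′ , h′ with third k k′
    ...       | i , i≢k , i≢k′ = contradiction
      (cong proj₂ (w-only (subst (cell c k′ ∈ᶜ_)
        (disjoint (rows i k′ i≢k′) h′ (rows i k i≢k) h) (w-cell c k′))))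
      k≢k′

    -- A common tile would contain a zero: the column recorded in `E` meets the pair row recorded in
    -- `E′` there.
    clash : ∀ {c} (E : Extra c) (E′ : Extra (next c)) → tile E ≢ tile E′
    clash {c} (extra row (inj₁ h) _) (extra {miss = i} row′ _ _) refl =
      pair-half⁻ (next c) i (next c) (sound row′ h) refl
    clash {c} (extra row (inj₂ (k , h)) _) (extra {miss = i} row′ _ _) refl =
      i≢next c (sym (proj₁ (pair-cell⁻ (next c) i c k (sound row′ h))))

    extras-bound : (∀ c → Extra c) → Bound
    extras-bound E = f , injective , inhabited
      where
      f : Col → Fin s
      f (inj₁ e) = w e
      f (half c) = tile (E c)

      injective : Injective _≡_ _≡_ f
      injective {inj₁ (c , i)} {inj₁ (d , k)} eq =
        cong inj₁ (w-only (subst (cell d k ∈ᶜ_) (sym eq) (w-cell d k)))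
      injective {inj₁ e} {half c} eq = contradiction (sym eq) (new (E c) e)
      injective {half c} {inj₁ e} eq = contradiction eq (new (E c) e)
      injective {half c} {half d} eq with c ≟ d
      ... | yes c≡d = cong inj₂ c≡d
      -- Any two distinct classes are cyclic neighbours, so `clash` handles every pair.
      ... | no c≢d with next-cases c≢d
      ...   | inj₁ refl = contradiction eq (clash (E c) (E d))
      ...   | inj₂ refl = contradiction (sym eq) (clash (E d) (E c))

      inhabited : ∀ y → Inhabited (f y)
      inhabited (cell c i) = (_ , lead-row c i _) , (_ , w-cell c i)
      inhabited (half c) with E c
      ... | extra row (inj₁ h) _ = (_ , row) , (_ , h)
      ... | extra row (inj₂ (_ , h)) _ = (_ , row) , (_ , h)

    lone-bound : Bound
    lone-bound = extras-bound extra-tile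

  abstract
    tiling-bound : Bound
    tiling-bound = split (any? λ c → any? λ i → all? (crowded? c i))
      where
      split : Dec (∃[ c ] ∃[ i ] ∀ j → Crowded c i j) → Bound
      split (yes (c , i , crowd)) = crowded-bound c i crowd
      split (no none) = lone-bound λ c i →
        ¬∀⟶∃¬ 3 (Crowded c i) (crowded? c i) λ crowd → none (c , i , crowd)

-- Factorizations as covers and tilings

bitℚ : Bool → ℚ
bitℚ b = if b then 1ℚ else 0ℚ

bit : Bool → ℝ
bit b = fromℚ (bitℚ b)

real : ∀ {n m} → (Fin n → Fin m → ℚ) → Matrix n m
real A i j = fromℚ (A i j)

0-1-matrix : ∀ {n m} → (Fin n → Fin m → Bool) → Matrix n m
0-1-matrix M = real λ i j → bitℚ (M i j)

bitℚ-nonneg : ∀ b → 0ℚ ℚ.≤ bitℚ b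
bitℚ-nonneg true  = ℚₚ.nonNegative⁻¹ 1ℚ
bitℚ-nonneg false = ℚₚ.≤-refl

bit-0-1 : ∀ b → bit b ≃ 0ℝ ⊎ bit b ≃ 1ℝ
bit-0-1 true  = inj₂ (≗⇒≃ 1ℝ 1ℝ λ _ → refl)
bit-0-1 false = inj₁ (≗⇒≃ 0ℝ 0ℝ λ _ → refl)

positive-bit : ∀ {b} → T b → Positive (bit b)
positive-bit {true} _ = positive-1

positive-bit⁻ : ∀ {b} → Positive (bit b) → T b
positive-bit⁻ {true}  _ = tt
positive-bit⁻ {false} p = ¬positive-0 p

¬1≺bit : ∀ b → ¬ 1ℚ ≺ bit b
¬1≺bit true  (N , h) = ℚₚ.<-irrefl refl (h N ℕₚ.≤-refl)
¬1≺bit false (N , h) = ℚₚ.<-asym (ℚₚ.positive⁻¹ 1ℚ) (h N ℕₚ.≤-refl)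

zeroOne⇒nonneg : ∀ x → x ≃ 0ℝ ⊎ x ≃ 1ℝ → 0ℝ Real.≤ x
zeroOne⇒nonneg x (inj₁ x≃0) = ≃⇒≥ {x} {0ℝ} x≃0
zeroOne⇒nonneg x (inj₂ x≃1) =
  ≤-trans 0ℝ 1ℝ x (fromℚ-mono-≤ (ℚₚ.nonNegative⁻¹ 1ℚ)) (≃⇒≥ {x} {1ℝ} x≃1)

-- Nonnegative terms cannot cancel: an entry is positive exactly when some product `U i l * V l j`
-- is, that is, when both of its factors are.
nonneg⇒cover : ∀ {n m s} (M : Fin n → Fin m → Bool) →
  HasNonnegativeFactorization (0-1-matrix M) s → Cover M s
nonneg⇒cover M (U , V , 0≤U , 0≤V , M≃UV) = record
  { _∈ʳ_   = λ i l → Positive (U i l)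
  ; _∈ᶜ_   = λ j l → Positive (V l j)
  ; covers = λ i j Mij →
      let l , UVl>0 = positive-sum⁻ (λ l → U i l Real.* V l j)
            (positive-≤ (bit (M i j)) ((U ⊗ V) i j) (positive-bit Mij)
              (≃⇒≤ {bit (M i j)} {(U ⊗ V) i j} (M≃UV i j)))
      in l , positive-*⁻ˡ (U i l) (V l j) (0≤U i l) UVl>0
           , positive-*⁻ʳ (U i l) (V l j) (0≤V l j) UVl>0
  ; sound  = λ {i} {j} {l} U>0 V>0 → positive-bit⁻
      (positive-≤ ((U ⊗ V) i j) (bit (M i j))
        (positive-≤ (U i l Real.* V l j) ((U ⊗ V) i j) (positive-* (U i l) (V l j) U>0 V>0)
          (term≤sum (λ l → U i l Real.* V l j)
            (λ l → *-nonneg (U i l) (V l j) (0≤U i l) (0≤V l j)) l))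
        (≃⇒≥ {bit (M i j)} {(U ⊗ V) i j} (M≃UV i j)))
  }

binary⇒tiling : ∀ {n m s} (M : Fin n → Fin m → Bool) →
  HasBinaryFactorization (0-1-matrix M) s → Tiling M s
binary⇒tiling M (U , V , U01 , V01 , M≃UV) = record
  { cover    = nonneg⇒cover M (U , V , 0≤U , 0≤V , M≃UV)
  ; _∈ᶜ?_    = λ j l → positive? (V l j) (V01 l j)
  ; disjoint = λ {i} {j} {l} {l′} → disjoint i j l l′
  }
  where
  0≤U : Real.IsNonnegative U
  0≤U i l = zeroOne⇒nonneg (U i l) (U01 i l)

  0≤V : Real.IsNonnegative V
  0≤V l j = zeroOne⇒nonneg (V l j) (V01 l j)

  -- Positivity of a real is not constructively decidable in general; the 0-1 alternative supplies
  -- the decision.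
  positive? : ∀ x → x ≃ 0ℝ ⊎ x ≃ 1ℝ → Dec (Positive x)
  positive? x (inj₁ x≃0) = no λ x>0 → ¬positive-0 (positive-≤ x 0ℝ x>0 (≃⇒≤ {x} {0ℝ} x≃0))
  positive? x (inj₂ x≃1) = yes (positive-≤ 1ℝ x positive-1 (≃⇒≥ {x} {1ℝ} x≃1))

  -- Any rational `q < 1` with `2q² > 1` suffices. The auxiliary `15/16` between `q` and 1 leaves
  -- the slack that `≺-≤-trans` requires.
  q : ℚ
  q = ℤ.+ 7 ℚ./ 8

  0<q : 0ℚ ℚ.< q
  0<q = ℚₚ.positive⁻¹ q

  q<15/16 : q ℚ.< ℤ.+ 15 ℚ./ 16
  q<15/16 = from-yes (q ℚₚ.<? ℤ.+ 15 ℚ./ 16)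

  15/16≺1 : ℤ.+ 15 ℚ./ 16 ≺ 1ℝ
  15/16≺1 = 0 , λ _ _ → from-yes (ℤ.+ 15 ℚ./ 16 ℚₚ.<? 1ℚ)

  1<q²+q² : 1ℚ ℚ.< q ℚ.* q ℚ.+ q ℚ.* q
  1<q²+q² = from-yes (1ℚ ℚₚ.<? q ℚ.* q ℚ.+ q ℚ.* q)

  q≺ : ∀ x → x ≃ 0ℝ ⊎ x ≃ 1ℝ → Positive x → q ≺ x
  q≺ x (inj₁ x≃0) x>0 = contradiction (positive-≤ x 0ℝ x>0 (≃⇒≤ {x} {0ℝ} x≃0)) ¬positive-0
  q≺ x (inj₂ x≃1) _ = ≺-≤-trans 1ℝ x q<15/16 15/16≺1 (≃⇒≥ {x} {1ℝ} x≃1)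

  -- Two distinct tiles through one entry would contribute more than 1 to it, the other terms are
  -- nonnegative, and the entry is at most 1.
  disjoint : ∀ i j l l′ → Positive (U i l) → Positive (V l j) →
    Positive (U i l′) → Positive (V l′ j) → l ≡ l′
  disjoint i j l l′ Ul Vl Ul′ Vl′ = decidable-stable (l ≟ l′) λ l≢l′ → ¬1≺bit (M i j)
    (≺-≤-trans (f l Real.+ f l′) (bit (M i j)) 1<q²+q²
      (≺-+ (f l) (f l′) (q²≺ l Ul Vl) (q²≺ l′ Ul′ Vl′))
      (≤-trans (f l Real.+ f l′) (sum f) (bit (M i j))
        (terms≤sum f (λ l → *-nonneg (U i l) (V l j) (0≤U i l) (0≤V l j)) l l′ l≢l′)
        (≃⇒≥ {bit (M i j)} {sum f} (M≃UV i j))))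
    where
    f : Fin _ → ℝ
    f l = U i l Real.* V l j
    q²≺ : ∀ l → Positive (U i l) → Positive (V l j) → q ℚ.* q ≺ f l
    q²≺ l Ul Vl = ≺-* (U i l) (V l j) 0<q 0<q (q≺ (U i l) (U01 i l) Ul) (q≺ (V l j) (V01 l j) Vl)

-- Rational sums and explicit factorizations

∑-single : ∀ {n} (f : Fin n → ℚ) b → (∀ i → b ≢ i → f i ≡ 0ℚ) → ∑ f ≡ f b
∑-single {ℕ.suc n} f zero h = trans
  (cong (f zero ℚ.+_) (trans (sum-cong-≗ λ i → h (suc i) λ ()) (sum-replicate-zero n)))
  (ℚₚ.+-identityʳ (f zero))
∑-single f (suc b) h = trans
  (cong₂ ℚ._+_ (h zero λ ()) (∑-single (f ∘ suc) b λ i b≢i → h (suc i) (b≢i ∘ suc-injective)))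
  (ℚₚ.+-identityˡ (f (suc b)))

∑-splitAt : ∀ m {n} (f : Fin m → ℚ) (g : Fin n → ℚ) →
  ∑ ([ f , g ]′ ∘ splitAt m) ≡ ∑ f ℚ.+ ∑ g
∑-splitAt ℕ.zero f g = sym (ℚₚ.+-identityˡ (∑ g))
∑-splitAt (ℕ.suc m) f g = trans
  (cong (f zero ℚ.+_) (trans (sum-cong-≗ λ i → [,]-map (splitAt m i)) (∑-splitAt m (f ∘ suc) g)))
  (sym (ℚₚ.+-assoc (f zero) _ _))

∑-remQuot : ∀ m {n} (g : Fin m × Fin n → ℚ) →
  ∑ {m * n} (g ∘ remQuot n) ≡ ∑ (λ b → ∑ (λ e → g (b , e)))
∑-remQuot ℕ.zero g = refl
∑-remQuot (ℕ.suc m) {n} g = trans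
  (sum-cong-≗ {n ℕ.+ m * n} λ i → [,]-∘ (g ∘ swap) (splitAt n i))
  (trans (∑-splitAt n _ _) (cong (∑ (λ e → g (zero , e)) ℚ.+_) (∑-remQuot m λ (b , e) → g (suc b , e))))

seq-sum : ∀ {r} (f : Fin r → ℝ) n → seq (sum f) n ≡ ∑ λ l → seq (f l) n
seq-sum {ℕ.zero} f n = refl
seq-sum {ℕ.suc r} f n = cong (seq (f zero) n ℚ.+_) (seq-sum (f ∘ suc) n)

-- All entries are constant sequences, so the identity over the reals is the rational identity at
-- every index.
real-⊗ : ∀ {n r m} (M : Fin n → Fin m → ℚ) (U : Fin n → Fin r → ℚ) (V : Fin r → Fin m → ℚ) →
  (∀ i j → ∑ (λ l → U i l ℚ.* V l j) ≡ M i j) → real M Real.≃ᴹ real U ⊗ real V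
real-⊗ M U V eq i j = ≗⇒≃ (fromℚ (M i j)) ((real U ⊗ real V) i j) λ n →
  sym (trans (seq-sum (λ l → real U i l Real.* real V l j) n) (eq i j))

-- The factorization is `M` times the identity matrix. For the diagonal copies, which have `q * 12`
-- columns, it is already optimal.
binary-trivial : ∀ {n m} (M : Fin n → Fin m → Bool) → HasBinaryFactorization (0-1-matrix M) m
binary-trivial {n} {m} M = real (λ i l → bitℚ (M i l)) , real (λ l j → bitℚ (I l j))
  , (λ i l → bit-0-1 (M i l)) , (λ l j → bit-0-1 (I l j))
  , real-⊗ (λ i j → bitℚ (M i j)) (λ i l → bitℚ (M i l)) (λ l j → bitℚ (I l j)) M*I
  where
  I : Fin m → Fin m → Bool
  I l j = does (l ≟ j)
  M*I : ∀ i j → ∑ (λ l → bitℚ (M i l) ℚ.* bitℚ (I l j)) ≡ bitℚ (M i j)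
  M*I i j = trans
    (∑-single (λ l → bitℚ (M i l) ℚ.* bitℚ (I l j)) j λ l j≢l → trans
      (cong (λ b → bitℚ (M i l) ℚ.* bitℚ b) (dec-false (l ≟ j) (j≢l ∘ sym)))
      (ℚₚ.*-zeroʳ (bitℚ (M i l))))
    (trans (cong (λ b → bitℚ (M i j) ℚ.* bitℚ b) (dec-true (j ≟ j) refl))
      (ℚₚ.*-identityʳ (bitℚ (M i j))))

-- Diagonal copies of the block

blocks : ∀ {q} → Fin q × Row → Fin q × Col → Bool
blocks (b , x) (b′ , y) = does (b ≟ b′) ∧ entry x y

blocks-diagonal : ∀ {q} (b : Fin q) x y → blocks (b , x) (b , y) ≡ entry x y
blocks-diagonal b x y = cong (_∧ entry x y) (dec-true (b ≟ b) refl)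

blocks⁻ : ∀ {q} (b b′ : Fin q) x y → T (blocks (b , x) (b′ , y)) → b ≡ b′ × T (entry x y)
blocks⁻ b b′ x y p with b ≟ b′
... | yes b≡b′ = b≡b′ , p

row↔ : ∀ {q} → Fin (q * 36) ↔ (Fin q × Row)
row↔ {q} = ↔-trans (*↔× {q} {36}) (↔-refl ×-↔
  ↔-trans (+↔⊎ {9} {27}) (*↔× {3} {3} ⊎-↔ ↔-trans (*↔× {3} {9}) (↔-refl ×-↔ *↔× {3} {3})))

col↔ : ∀ {q} → Fin (q * 12) ↔ (Fin q × Col)
col↔ {q} = ↔-trans (*↔× {q} {12}) (↔-refl ×-↔ ↔-trans (+↔⊎ {9} {3}) (*↔× {3} {3} ⊎-↔ ↔-refl))

factor↔ : ∀ {q} → Fin (q * 9) ↔ (Fin q × Cell)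
factor↔ {q} = ↔-trans (*↔× {q} {9}) (↔-refl ×-↔ *↔× {3} {3})

open Inverse using (to; from; strictlyInverseˡ)

table : ∀ q → Fin (q * 36) → Fin (q * 12) → Bool
table q i j = blocks (to (row↔ {q}) i) (to (col↔ {q}) j)

table-from : ∀ q x y → table q (from (row↔ {q}) x) (from (col↔ {q}) y) ≡ blocks x y
table-from q x y = cong₂ blocks (strictlyInverseˡ (row↔ {q}) x) (strictlyInverseˡ (col↔ {q}) y)

to-injective : ∀ {A B : Set} (e : A ↔ B) → Injective _≡_ _≡_ (to e)
to-injective e {x} {y} eq =
  trans (sym (Inverse.strictlyInverseʳ e x)) (trans (cong (from e) eq) (Inverse.strictlyInverseʳ e y))

nonnegative-bound : ∀ q s → Cover (table q) s → q * 9 ℕ.≤ s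
nonnegative-bound q s C = injective⇒≤ {f = λ l → tile (to (factor↔ {q}) l)} λ eq →
  to-injective (factor↔ {q}) (fooling a b on off C′ eq)
  where
  C′ : Cover (blocks {q}) s
  C′ = restrict (from (row↔ {q})) (from (col↔ {q})) (table-from q) C
  a : Fin q × Cell → Fin q × Row
  a (z , c , i) = z , pair c i
  b : Fin q × Cell → Fin q × Col
  b (z , c , i) = z , cell c (next i)
  on : ∀ e → T (blocks (a e) (b e))
  on (z , c , i) = subst T (sym (blocks-diagonal z (pair c i) (cell c (next i)))) (pair-on (c , i))
  -- Crossed entries between different blocks are zero; inside a block `pair-off` applies.
  off : ∀ e e′ → T (blocks (a e) (b e′)) → T (blocks (a e′) (b e)) → e ≡ e′
  off (z , c , i) (z′ , c′ , i′) p p′ =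
    let z≡z′ , r  = blocks⁻ z z′ (pair c i) (cell c′ (next i′)) p
        _    , r′ = blocks⁻ z′ z (pair c′ i′) (cell c (next i)) p′
    in cong₂ _,_ z≡z′ (pair-off (c , i) (c′ , i′) r r′)
  tile : Fin q × Cell → Fin s
  tile e = proj₁ (Cover.covers C′ (a e) (b e) (on e))

binary-bound : ∀ q s → Tiling (table q) s → q * 12 ℕ.≤ s
binary-bound q s t = injective⇒≤ {f = λ l → tile (to (col↔ {q}) l)} (to-injective (col↔ {q}) ∘ tile-injective)
  where
  t′ : Tiling (blocks {q}) s
  t′ = restrictTiling (from (row↔ {q})) (from (col↔ {q})) (table-from q) t
  open Tiling t′
  bound : (b : Fin q) → Bound (restrictTiling (b ,_) (b ,_) (blocks-diagonal b) t′)
  bound b = tiling-bound (restrictTiling (b ,_) (b ,_) (blocks-diagonal b) t′)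
  tile : Fin q × Col → Fin s
  tile (b , y) = proj₁ (bound b) y
  -- A common tile has a row in block `b` and a column in block `b′`. Their entry is a one, and ones
  -- occur only within a block.
  same-block : ∀ b b′ y y′ → tile (b , y) ≡ tile (b′ , y′) → b ≡ b′
  same-block b b′ y y′ eq =
    let (x , x∈) , _ = proj₂ (proj₂ (bound b)) y
        _ , (z , z∈) = proj₂ (proj₂ (bound b′)) y′
    in proj₁ (blocks⁻ b b′ x z (sound {b , x} {b′ , z} x∈ (subst ((b′ , z) ∈ᶜ_) (sym eq) z∈)))
  tile-injective : Injective _≡_ _≡_ tile
  tile-injective {b , y} {b′ , y′} eq = within (same-block b b′ y y′ eq) eq
    where
    within : ∀ {b b′} → b ≡ b′ → ∀ {y y′} → tile (b , y) ≡ tile (b′ , y′) → (b , y) ≡ (b′ , y′)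
    within {b} refl eq = cong (b ,_) (proj₁ (proj₂ (bound b)) eq)

-- The nonnegative factorization of the diagonal copies

weight : Cell → Col → ℚ
weight (c , i) (cell d k) = bitℚ (does (c ≟ d) ∧ does (i ≟ k))
weight (c , i) (half d)   = if does (c ≟ d) then 0ℚ else ½

weight-nonneg : ∀ e y → 0ℚ ℚ.≤ weight e y
weight-nonneg (c , i) (cell d k) = bitℚ-nonneg (does (c ≟ d) ∧ does (i ≟ k))
weight-nonneg (c , i) (half d) with does (c ≟ d)
... | true  = ℚₚ.≤-refl
... | false = ℚₚ.nonNegative⁻¹ ½

cellOf : Fin 9 → Cell
cellOf = remQuot {3} 3

module _ (x : Row) (y : Col) where

  IsFactored : Set
  IsFactored =
    ∑ (λ e → bitℚ (entry x (inj₁ (cellOf e))) ℚ.* weight (cellOf e) y) ≡ bitℚ (entry x y)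

  isFactored? : Dec IsFactored
  isFactored? = _ ℚₚ.≟ _

abstract
  -- The left factor consists of the nine cell columns of the block, and `weight` holds the
  -- coefficients of every column in terms of them. The finitely many identities are verified by
  -- rational computation.
  isFactored : ∀ x y → IsFactored x y
  isFactored (pair c i) (cell d k) =
    from-yes (all? λ c → all? λ i → all? λ d → all? λ k → isFactored? (pair c i) (cell d k)) c i d k
  isFactored (pair c i) (half d) =
    from-yes (all? λ c → all? λ i → all? λ d → isFactored? (pair c i) (half d)) c i d
  isFactored (triple c i j) (cell d k) =
    from-yes (all? λ c → all? λ i → all? λ j → all? λ d → all? λ k →
      isFactored? (triple c i j) (cell d k)) c i j d k
  isFactored (triple c i j) (half d) =
    from-yes (all? λ c → all? λ i → all? λ j → all? λ d → isFactored? (triple c i j) (half d)) c i j d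

blockWeight : ∀ {q} → Fin q × Cell → Fin q × Col → ℚ
blockWeight (b , e) (b′ , y) = if does (b ≟ b′) then weight e y else 0ℚ

blockWeight-nonneg : ∀ {q} (l : Fin q × Cell) y → 0ℚ ℚ.≤ blockWeight l y
blockWeight-nonneg (b , e) (b′ , y) with does (b ≟ b′)
... | true  = weight-nonneg e y
... | false = ℚₚ.≤-refl

blocks-factored : ∀ {q} (x : Fin q × Row) y →
  ∑ (λ b → ∑ λ e → bitℚ (blocks x (b , inj₁ (cellOf e))) ℚ.* blockWeight (b , cellOf e) y)
    ≡ bitℚ (blocks x y)
blocks-factored {q} (b , x) (b′ , y) = trans (∑-single (λ c → term (does (b ≟ c)) c) b off)
  (trans (cong (λ t → term t b) (dec-true (b ≟ b) refl)) (diagonal (does (b ≟ b′))))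
  where
  -- The truth value of `b ≟ c` is a separate argument, so that it can be replaced by false off the
  -- diagonal and by true on it.
  term : Bool → Fin q → ℚ
  term t c = ∑ λ e → bitℚ (t ∧ entry x (inj₁ (cellOf e))) ℚ.* blockWeight (c , cellOf e) (b′ , y)

  off : ∀ c → b ≢ c → term (does (b ≟ c)) c ≡ 0ℚ
  off c b≢c = trans (cong (λ t → term t c) (dec-false (b ≟ c) b≢c))
    (trans (sum-cong-≗ λ e → ℚₚ.*-zeroˡ (blockWeight (c , cellOf e) (b′ , y))) (sum-replicate-zero 9))

  diagonal : ∀ t →
    ∑ (λ e → bitℚ (entry x (inj₁ (cellOf e))) ℚ.* (if t then weight (cellOf e) y else 0ℚ))
      ≡ bitℚ (t ∧ entry x y)
  diagonal true  = isFactored x y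
  diagonal false =
    trans (sum-cong-≗ λ e → ℚₚ.*-zeroʳ (bitℚ (entry x (inj₁ (cellOf e))))) (sum-replicate-zero 9)

nonnegative-factorization : ∀ q → HasNonnegativeFactorization (0-1-matrix (table q)) (q * 9)
nonnegative-factorization q = real U , real V
  , (λ i l → fromℚ-mono-≤ (bitℚ-nonneg (blocks (to (row↔ {q}) i) (left (remQuot 9 l)))))
  , (λ l j → fromℚ-mono-≤ (blockWeight-nonneg (right (remQuot 9 l)) (to (col↔ {q}) j)))
  , real-⊗ (λ i j → bitℚ (table q i j)) U V λ i j →
      trans (∑-remQuot q λ p →
          bitℚ (blocks (to (row↔ {q}) i) (left p)) ℚ.* blockWeight (right p) (to (col↔ {q}) j))
        (blocks-factored (to (row↔ {q}) i) (to (col↔ {q}) j))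
  where
  left : Fin q × Fin 9 → Fin q × Col
  left (b , e) = b , inj₁ (cellOf e)
  right : Fin q × Fin 9 → Fin q × Cell
  right (b , e) = b , cellOf e
  U : Fin (q * 36) → Fin (q * 9) → ℚ
  U i l = bitℚ (blocks (to (row↔ {q}) i) (left (remQuot 9 l)))
  V : Fin (q * 9) → Fin (q * 12) → ℚ
  V l j = blockWeight (right (remQuot 9 l)) (to (col↔ {q}) j)

4*9q/3≡12q : ∀ q → (4 * (q * 9)) / 3 ≡ q * 12
4*9q/3≡12q q = trans
  (cong (_/ 3) (trans (ℕₚ.*-comm 4 (q * 9)) (trans (ℕₚ.*-assoc q 9 4) (sym (ℕₚ.*-assoc q 12 3)))))
  (m*n/n≡m (q * 12) 3)

mainTheorem3 : (k : ℕ) → 0 < k → 9 ∣ k →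
    ∃[ n ] ∃[ m ] Σ[ M ∈ Matrix n m ]
    IsZeroOne M × NonnegativeRank M k × BinaryRank M ((4 * k) / 3)
mainTheorem3 .(q * 9) _ (divides q refl) = q * 36 , q * 12 , 0-1-matrix (table q)
  , (λ i j → bit-0-1 (table q i j))
  , (nonnegative-factorization q , λ s F → nonnegative-bound q s (nonneg⇒cover (table q) F))
  , subst (BinaryRank (0-1-matrix (table q))) (sym (4*9q/3≡12q q))
      (binary-trivial (table q) , λ s F → binary-bound q s (binary⇒tiling (table q) F))
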